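{- Let $G$ be a finite simple graph with girth at least $9$. Then $\chi_b(G) \ge m(G) - 1$.
   Context: A b-vertex of a (proper) vertex coloring is a vertex that has a neighbor of every color other than its own. A b-coloring of $G$ is a proper vertex coloring in which every color class contains a b-vertex. The b-chromatic number $\chi_b(G)$ is the largest integer $k$ such that $G$ has a b-coloring with exactly $k$ colors. $m(G)$ denotes the largest integer $k$ such that $G$ has at least $k$ vertices of degree at least $k-1$. The girth of $G$ is the length of a shortest cycle of $G$ (infinite if $G$ is acyclic). -}

module Defs where

open import Data.Nat using (ℕ; zero; suc; _+_; _≤_; _∸_)
open import Data.Bool using (Bool; true; false; if_then_else_)
open import Data.Fin using (Fin; toℕ)
open import Data.List using (List; map; allFin)
open import Data.Nat.ListAction using (sum)
open import Data.Product using (Σ; _×_; _,_; ∃)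
open import Relation.Binary.PropositionalEquality using (_≡_)
open import Relation.Nullary using (¬_)
open import Function.Definitions using (Injective)

record Graph : Set where
  field
    n      : ℕ
    adj    : Fin n → Fin n → Bool
    sym    : ∀ u v → adj u v ≡ adj v u
    irrefl : ∀ v → adj v v ≡ false

module _ (G : Graph) where
  open Graph G

  Adj : Fin n → Fin n → Set
  Adj u v = adj u v ≡ true

  degree : Fin n → ℕ
  degree v = sum (map (λ u → if adj v u then 1 else 0) (allFin n))

  record Cycle (k : ℕ) : Set where
    field
      len≥3   : 3 ≤ k
      vert    : Fin k → Fin n
      distinct : Injective _≡_ _≡_ vert
      consec  : ∀ (i j : Fin k) → suc (toℕ i) ≡ toℕ j → Adj (vert i) (vert j)
      closing : ∀ (i j : Fin k) → suc (toℕ i) ≡ k → toℕ j ≡ 0 → Adj (vert i) (vert j)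

  -- girth at least g: every cycle has length at least g
  -- (vacuous for acyclic graphs, whose girth is infinite)
  GirthAtLeast : ℕ → Set
  GirthAtLeast g = ∀ k → Cycle k → g ≤ k

  Proper : {k : ℕ} → (Fin n → Fin k) → Set
  Proper c = ∀ u v → Adj u v → ¬ (c u ≡ c v)

  IsBVertex : {k : ℕ} → (Fin n → Fin k) → Fin n → Set
  IsBVertex c v = ∀ j → ¬ (j ≡ c v) → Σ (Fin n) λ u → Adj v u × (c u ≡ j)

  IsBColoring : {k : ℕ} → (Fin n → Fin k) → Set
  IsBColoring c = Proper c × (∀ i → Σ (Fin n) λ v → (c v ≡ i) × IsBVertex c v)

  HasBColoring : ℕ → Set
  HasBColoring k = Σ (Fin n → Fin k) IsBColoring

  IsBChromaticNumber : ℕ → Set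
  IsBChromaticNumber b = HasBColoring b × (∀ k → HasBColoring k → k ≤ b)

  MProperty : ℕ → Set
  MProperty k = Σ (Fin k → Fin n) λ f → Injective _≡_ _≡_ f × (∀ i → k ∸ 1 ≤ degree (f i))

  IsMNumber : ℕ → Set
  IsMNumber m = MProperty m × (∀ k → MProperty k → k ≤ m)

{-# OPTIONS --safe #-}
-- Let m = k + 1. Choose m distinct "roots" w i of degree at least k which include every vertex of degree at least m,
-- and give w i the colour i. Every other vertex has degree at most k, so a partial colouring with m colours always
-- extends greedily. It is therefore enough to colour part of the neighbourhoods of the roots so that all roots w i,
-- except possibly one w r, see every colour: if colour r then has no b-vertex, its class can be distributed over the
-- other colours, leaving a b-colouring with m - 1 colours.
--
-- A neighbour u of w i matters if it is a link (adjacent to at least two roots) or is adjacent to another non-root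
-- neighbour of a root. Such a u gets a colour l for which w l lies at a short distance from u along a path of a
-- prescribed shape; two vertices in conflict over l would then close a non-backtracking walk of length at most 8.
-- Once these vertices are coloured, the remaining neighbours of w i can take the missing colours freely.
-- If all roots are within distance 2 of a link through its own root neighbours, there is no good colour for that link;
-- such a link is unique, and colouring it costs one root w r.
module Submission where

open import Defs
open import Data.Nat using (ℕ; zero; suc; _+_; _≤_; _<_; _∸_; z≤n; s≤s; _≤?_)
open import Data.Nat.Properties using (≤-trans; ≤-reflexive; ≤-<-trans; <-cmp; 1+n≰n; +-assoc; +-comm; +-suc; m≤m+n; m≤n+m; +-monoˡ-≤; n≤1+n; <⇒≱; m≤n⇒∃[o]m+o≡n)
open import Data.Nat.Induction using (<-rec)
open import Data.Nat.ListAction using (sum)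
open import Data.Bool using (Bool; true; false; if_then_else_)
import Data.Bool as Bool
open import Data.Fin using (Fin; zero; suc; toℕ; inject≤; punchIn; punchOut; _≟_)
open import Data.Fin.Properties using (any?; all?; toℕ<n; toℕ-injective; inject≤-injective; suc-injective; injective⇒≤; punchIn-injective; punchInᵢ≢i; punchIn-punchOut)
open import Data.List using (List; []; _∷_; _++_; length; tabulate)
open import Data.List.Properties using (map-tabulate)
open import Data.Maybe using (Maybe; just; nothing)
open import Data.Maybe.Properties using (just-injective; ≡-dec)
open import Data.Product using (Σ; ∃; ∃₂; _×_; _,_; proj₁; proj₂)
open import Data.Sum using (_⊎_; inj₁; inj₂; [_,_]′)
open import Data.Empty using (⊥-elim)
open import Data.Unit using (⊤)
open import Data.Vec.Functional using () renaming (_∷_ to _∷ᶠ_)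
open import Function using (_∘_; id)
open import Function.Definitions using (Injective)
open import Relation.Binary.Definitions using (tri<; tri≈; tri>)
open import Relation.Binary.PropositionalEquality using (_≡_; _≢_; refl; sym; trans; cong; subst; ≢-sym)
open import Relation.Nullary using (¬_; Dec; yes; no; contradiction; ¬?; _×-dec_; _⊎-dec_; _→-dec_)
open import Relation.Nullary.Decidable using (True; toWitness; decidable-stable)

-- Injections, iterated steps, rotations of a subset, counting

∷ᶠ-injective : ∀ {A : Set} {k} (a : A) {f : Fin k → A} → Injective _≡_ _≡_ f → (∀ i → f i ≢ a) → Injective _≡_ _≡_ (a ∷ᶠ f)
∷ᶠ-injective a inj a∉f {zero}  {zero}  e = refl
∷ᶠ-injective a inj a∉f {zero}  {suc j} e = contradiction (sym e) (a∉f j)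
∷ᶠ-injective a inj a∉f {suc i} {zero}  e = contradiction e (a∉f i)
∷ᶠ-injective a inj a∉f {suc i} {suc j} e = cong suc (inj e)

-- Goals that survive every later step can be met one at a time. This drives the serving of the
-- roots, the greedy completion and the choice of the roots.
perform : ∀ {S : Set} (_⊑_ : S → S → Set) → (∀ {s} → s ⊑ s) → (∀ {s t u} → s ⊑ t → t ⊑ u → s ⊑ u) →
  ∀ k (Done : Fin k → S → Set) → (∀ i {s t} → s ⊑ t → Done i s → Done i t) →
  (∀ i s → ∃ λ t → s ⊑ t × Done i t) → ∀ s → ∃ λ t → s ⊑ t × (∀ i → Done i t)
perform _⊑_ ⊑-refl ⊑-trans zero Done mono step s = s , ⊑-refl , λ ()
perform _⊑_ ⊑-refl ⊑-trans (suc k) Done mono step s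
  with t , s⊑t , d ← step zero s
  with u , t⊑u , ds ← perform _⊑_ ⊑-refl ⊑-trans k (Done ∘ suc) (mono ∘ suc) (step ∘ suc) t
  = u , ⊑-trans s⊑t t⊑u , λ { zero → mono zero t⊑u d ; (suc i) → ds i }

-- A permutation of the vertices satisfying `P`, with a fixed point only when `P` holds for a single
-- vertex. Vertices around a root look to their images for a colour, and injectivity keeps two of
-- them from looking at the same vertex.
record Rotation {n} (P : Fin n → Set) : Set where
  field
    rotate    : Fin n → Fin n
    preserves : ∀ {u} → P u → P (rotate u)
    injective : ∀ {u v} → P u → P v → rotate u ≡ rotate v → u ≡ v
    moves     : ∀ {u v} → P u → P v → rotate u ≡ u → v ≡ u

rotation : ∀ {n} (P : Fin n → Set) → (∀ v → Dec (P v)) → Rotation P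
rotation {zero} P P? = record { rotate = id ; preserves = id ; injective = λ _ _ → id ; moves = λ { {()} } }
rotation {suc n} P P? with rotation (P ∘ suc) (P? ∘ suc) | P? zero | any? (P? ∘ suc)
... | ρ | no ¬p0 | _ = record
  { rotate = rot
  ; preserves = λ { {zero} p → contradiction p ¬p0 ; {suc u} p → preserves p }
  ; injective = λ { {zero} p _ _ → contradiction p ¬p0 ; {suc _} {zero} _ p _ → contradiction p ¬p0
                  ; {suc u} {suc v} p q e → cong suc (injective p q (suc-injective e)) }
  ; moves = λ { {zero} p _ _ → contradiction p ¬p0 ; {suc _} {zero} _ p _ → contradiction p ¬p0
              ; {suc u} {suc v} p q e → cong suc (moves p q (suc-injective e)) } }
  where
  open Rotation ρ
  rot : Fin (suc n) → Fin (suc n)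
  rot zero    = zero
  rot (suc u) = suc (rotate u)
... | ρ | yes p0 | no ¬ps = record
  { rotate = λ _ → zero
  ; preserves = λ _ → p0
  ; injective = λ p q _ → trans (only p) (sym (only q))
  ; moves = λ p q _ → trans (only q) (sym (only p)) }
  where
  only : ∀ {u} → P u → u ≡ zero
  only {zero}  _ = refl
  only {suc u} p = contradiction (u , p) ¬ps
-- Zero is inserted just before the image of p on its cycle.
... | ρ | yes p0 | yes (p , Pp) = record
  { rotate = rot ; preserves = λ {u} → pres u ; injective = λ {u} {v} → inj u v ; moves = λ {u} {v} → mov u v }
  where
  open Rotation ρ
  rot : Fin (suc n) → Fin (suc n)
  rot zero = suc (rotate p)
  rot (suc u) with u ≟ p
  ... | yes _ = zero
  ... | no _  = suc (rotate u)
  pres : ∀ u → P u → P (rot u)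
  pres zero _ = preserves Pp
  pres (suc u) q with u ≟ p
  ... | yes _ = p0
  ... | no _  = preserves q
  inj : ∀ u v → P u → P v → rot u ≡ rot v → u ≡ v
  inj zero zero _ _ _ = refl
  inj zero (suc v) _ q e with v ≟ p
  ... | no v≢p = contradiction (injective q Pp (sym (suc-injective e))) v≢p
  inj (suc u) zero q _ e with u ≟ p
  ... | no u≢p = contradiction (injective q Pp (suc-injective e)) u≢p
  inj (suc u) (suc v) q q′ e with u ≟ p | v ≟ p
  ... | yes refl | yes refl = refl
  ... | no _ | no _ = cong suc (injective q q′ (suc-injective e))
  mov : ∀ u v → P u → P v → rot u ≡ u → v ≡ u
  mov (suc u) v q _ e with u ≟ p
  -- A fixed point of the smaller rotation forces `p` to equal it, so none survives the insertion.
  ... | no u≢p = contradiction (sym (moves q Pp (suc-injective e))) u≢p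

count : ∀ {n} → (Fin n → Bool) → ℕ
count b = sum (tabulate (λ i → if b i then 1 else 0))

enumerate : ∀ {n} (b : Fin n → Bool) → Σ (Fin (count b) → Fin n) λ f → Injective _≡_ _≡_ f × (∀ i → b (f i) ≡ true)
enumerate {zero} b = (λ ()) , (λ { {()} }) , λ ()
enumerate {suc n} b with b zero in b0 | enumerate (b ∘ suc)
... | true  | f , f-inj , f-true = (zero ∷ᶠ (suc ∘ f)) , ∷ᶠ-injective zero (f-inj ∘ suc-injective) (λ _ ())
                                  , λ { zero → b0 ; (suc i) → f-true i }
... | false | f , f-inj , f-true = suc ∘ f , f-inj ∘ suc-injective , f-true

indexing : ∀ {n} (b : Fin n → Bool) → Σ (∀ i → b i ≡ true → Fin (count b)) λ f → ∀ i j p q → f i p ≡ f j q → i ≡ j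
indexing {zero} b = (λ ()) , λ ()
indexing {suc n} b with b zero in b0 | indexing (b ∘ suc)
... | true | f , f-inj =
  (λ { zero _ → zero ; (suc i) p → suc (f i p) }) ,
  λ { zero zero _ _ _ → refl ; (suc i) (suc j) p q e → cong suc (f-inj i j p q (suc-injective e)) }
... | false | f , f-inj =
  (λ { zero p → contradiction (trans (sym p) b0) λ () ; (suc i) p → f i p }) ,
  λ { zero _ p _ _ → contradiction (trans (sym p) b0) λ ()
    ; (suc _) zero _ q _ → contradiction (trans (sym q) b0) λ ()
    ; (suc i) (suc j) p q e → cong suc (f-inj i j p q e) }

-- Degrees and the merging of a colour class

module _ (G : Graph) where
  open Graph G renaming (sym to adj-comm)

  degree≡count : ∀ v → degree G v ≡ count (adj v)
  degree≡count v = cong sum (map-tabulate id (λ u → if adj v u then 1 else 0))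

  neighbours : ∀ {k} v → k ≤ degree G v → Σ (Fin k → Fin n) λ f → Injective _≡_ _≡_ f × (∀ i → Adj G v (f i))
  neighbours v k≤d with f , f-inj , f-adj ← enumerate (adj v)
    = (λ i → f (inject≤ i k≤c)) , (λ e → inject≤-injective k≤c k≤c _ _ (f-inj e)) , λ i → f-adj (inject≤ i k≤c)
    where k≤c = subst (_ ≤_) (degree≡count v) k≤d

  injective⇒≤degree : ∀ {k} v {f : Fin k → Fin n} → Injective _≡_ _≡_ f → (∀ i → Adj G v (f i)) → k ≤ degree G v
  injective⇒≤degree {k} v f-inj f-adj with index , index-inj ← indexing (adj v)
    = subst (k ≤_) (sym (degree≡count v))
        (injective⇒≤ {f = λ i → index _ (f-adj i)} (λ e → f-inj (index-inj _ _ _ _ e)))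

  sees? : ∀ {k} (c : Fin n → Fin k) v j → Dec (Σ (Fin n) λ u → Adj G v u × c u ≡ j)
  sees? c v j = any? λ u → (adj v u Bool.≟ true) ×-dec (c u ≟ j)

  -- Colours that still have a b-vertex keep it, since no vertex outside the colour class r is recoloured.
  mergeColour : ∀ {k} (c : Fin n → Fin (suc k)) → Proper G c → ∀ r →
    (∀ i → i ≢ r → Σ (Fin n) λ v → c v ≡ i × IsBVertex G c v) → HasBColoring G (suc k) ⊎ HasBColoring G k
  mergeColour {k} c proper r b with any? (λ v → (c v ≟ r) ×-dec all? (λ j → ¬? (j ≟ c v) →-dec sees? c v j))
  ... | yes r-b = inj₁ (c , proper , bvertex)
    where
    bvertex : ∀ i → Σ (Fin n) λ v → c v ≡ i × IsBVertex G c v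
    bvertex i with i ≟ r
    ... | yes refl = r-b
    ... | no i≢r   = b i i≢r
  ... | no ¬r-b = inj₂ (c′ , proper′ , bvertex)
    where
    Recolour : Fin n → Fin (suc k) → Set
    Recolour v j = r ≢ j × (c v ≡ j ⊎ (c v ≡ r × (∀ u → Adj G v u → c u ≢ j)))
    recolour : ∀ v → ∃ (Recolour v)
    recolour v with c v ≟ r
    ... | no cv≢r = c v , ≢-sym cv≢r , inj₁ refl
    ... | yes cv≡r with any? (λ j → ¬? (r ≟ j) ×-dec ¬? (sees? c v j))
    ...   | yes (j , r≢j , ¬sees) = j , r≢j , inj₂ (cv≡r , λ u vu cu → ¬sees (u , vu , cu))
    -- Were no colour missing around `v`, it would be a b-vertex of colour `r`, which this branch
    -- excludes.
    ...   | no ¬missing = contradiction (v , cv≡r , λ j j≢cv →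
              decidable-stable (sees? c v j) λ ¬sees → ¬missing (j , (λ r≡j → j≢cv (trans (sym r≡j) (sym cv≡r))) , ¬sees)) ¬r-b
    c′ : Fin n → Fin k
    c′ v = punchOut (proj₁ (proj₂ (recolour v)))
    c′-recolour : ∀ v → punchIn r (c′ v) ≡ proj₁ (recolour v)
    c′-recolour v = punchIn-punchOut (proj₁ (proj₂ (recolour v)))
    unchanged : ∀ v → c v ≢ r → punchIn r (c′ v) ≡ c v
    unchanged v cv≢r with c′-recolour v | proj₂ (proj₂ (recolour v))
    ... | e | inj₁ cv≡j       = trans e (sym cv≡j)
    ... | e | inj₂ (cv≡r , _) = contradiction cv≡r cv≢r
    proper′ : Proper G c′
    proper′ u v uv e with trans (trans (sym (c′-recolour u)) (cong (punchIn r) e)) (c′-recolour v)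
                        | proj₂ (proj₂ (recolour u)) | proj₂ (proj₂ (recolour v))
    ... | ju≡jv | inj₁ cu | inj₁ cv = proper u v uv (trans cu (trans ju≡jv (sym cv)))
    ... | ju≡jv | inj₁ cu | inj₂ (_ , avoids) = avoids u (trans (adj-comm v u) uv) (trans cu ju≡jv)
    ... | ju≡jv | inj₂ (_ , avoids) | inj₁ cv = avoids v uv (trans cv (sym ju≡jv))
    ... | _ | inj₂ (cu , _) | inj₂ (cv , _) = proper u v uv (trans cu (sym cv))
    bvertex : ∀ i → Σ (Fin n) λ v → c′ v ≡ i × IsBVertex G c′ v
    bvertex i with v , cv , v-b ← b (punchIn r i) (punchInᵢ≢i r i)
      = v , same v i cv , λ j j≢ → case-b v cv v-b j j≢
      where
      same : ∀ v i → c v ≡ punchIn r i → c′ v ≡ i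
      same v i cv = punchIn-injective r _ _ (trans (unchanged v (λ e → punchInᵢ≢i r i (trans (sym cv) e))) cv)
      case-b : ∀ v → c v ≡ punchIn r i → IsBVertex G c v → IsBVertex G c′ v
      case-b v cv v-b j j≢ with u , vu , cu ← v-b (punchIn r j)
               (λ e → j≢ (sym (same v j (sym e)))) = u , vu , same u j cu

-- Girth and non-backtracking walks

module LargeGirth (G : Graph) (girth≥9 : GirthAtLeast G 9) where
  open Graph G renaming (sym to adj-comm)

  V : Set
  V = Fin n

  infix 4 _~_
  _~_ : V → V → Set
  u ~ v = Adj G u v

  _~?_ : ∀ u v → Dec (u ~ v)
  u ~? v = adj u v Bool.≟ true

  ~-sym : ∀ {u v} → u ~ v → v ~ u
  ~-sym {u} {v} uv = trans (adj-comm v u) uv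

  ~⇒≢ : ∀ {u v} → u ~ v → u ≢ v
  ~⇒≢ {u} uu refl = contradiction (trans (sym uu) (irrefl u)) λ ()

  -- Strong induction on the gap `g`. Adjacency and the absence of backtracking exclude gaps 1 and
  -- 2; for a larger gap the induction makes the vertices in between distinct, so they form a cycle
  -- of length at most 8.
  noReturn : ∀ (f : ℕ → V) L → L ≤ 8 → (∀ i → i < L → f i ~ f (suc i)) → (∀ i → suc i < L → f i ≢ f (suc (suc i))) →
    ∀ g → 0 < g → ∀ i → g + i ≤ L → f i ≢ f (g + i)
  noReturn f L L≤8 step turn = <-rec (λ g → 0 < g → ∀ i → g + i ≤ L → f i ≢ f (g + i)) go
    where
    go : ∀ g → (∀ {h} → h < g → 0 < h → ∀ i → h + i ≤ L → f i ≢ f (h + i)) → 0 < g → ∀ i → g + i ≤ L → f i ≢ f (g + i)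
    go 1 _ _ i i<L e = ~⇒≢ (step i i<L) e
    go 2 _ _ i i<L e = turn i i<L e
    go g@(suc (suc (suc _))) rec _ i g+i≤L e = <⇒≱ (s≤s (≤-trans (m≤m+n g i) (≤-trans g+i≤L L≤8))) (girth≥9 g cycle)
      where
      within : ∀ (s : Fin g) → suc (toℕ s) + i ≤ L
      within s = ≤-trans (+-monoˡ-≤ i (toℕ<n s)) g+i≤L
      earlier : ∀ (s t : Fin g) → toℕ s < toℕ t → f (toℕ s + i) ≢ f (toℕ t + i)
      earlier s t s<t e′ with o , s+o≡t ← m≤n⇒∃[o]m+o≡n s<t = rec {suc o}
        (≤-<-trans (≤-trans (m≤n+m (suc o) (toℕ s)) (≤-reflexive gap)) (toℕ<n t)) (s≤s z≤n) (toℕ s + i)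
        (≤-trans (≤-reflexive shift) (≤-trans (n≤1+n _) (within t))) (trans e′ (cong f (sym shift)))
        where
        gap : toℕ s + suc o ≡ toℕ t
        gap = trans (+-suc (toℕ s) o) s+o≡t
        shift : suc o + (toℕ s + i) ≡ toℕ t + i
        shift = trans (sym (+-assoc (suc o) (toℕ s) i)) (cong (_+ i) (trans (+-comm (suc o) (toℕ s)) gap))
      cycle : Cycle G g
      cycle = record
        { len≥3 = s≤s (s≤s (s≤s z≤n))
        ; vert = λ s → f (toℕ s + i)
        ; distinct = distinct
        ; consec = λ s t e′ → subst (λ x → f (toℕ s + i) ~ f (x + i)) e′ (step _ (within s))
        ; closing = λ s t e′ t≡0 → subst (f (toℕ s + i) ~_)
            (trans (cong (λ x → f (x + i)) e′) (trans (sym e) (cong (λ x → f (x + i)) (sym t≡0)))) (step _ (within s)) }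
        where
        distinct : Injective _≡_ _≡_ (λ (s : Fin g) → f (toℕ s + i))
        distinct {s} {t} e′ with <-cmp (toℕ s) (toℕ t)
        ... | tri< s<t _ _ = contradiction e′ (earlier s t s<t)
        ... | tri≈ _ s≡t _ = toℕ-injective s≡t
        ... | tri> _ _ t<s = contradiction (sym e′) (earlier t s t<s)

  NonBacktracking : List V → Set
  NonBacktracking (u ∷ v ∷ w ∷ ws) = u ~ v × u ≢ w × NonBacktracking (v ∷ w ∷ ws)
  NonBacktracking (u ∷ v ∷ [])     = u ~ v
  NonBacktracking _                = ⊤

  nth : V → List V → ℕ → V
  nth d []       _       = d
  nth d (x ∷ xs) zero    = x
  nth d (x ∷ xs) (suc i) = nth d xs i

  nth-step : ∀ d xs → NonBacktracking xs → ∀ i → suc i < length xs → nth d xs i ~ nth d xs (suc i)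
  nth-step d (u ∷ [])         _            _       (s≤s ())
  nth-step d (u ∷ v ∷ [])     uv           zero    _ = uv
  nth-step d (u ∷ v ∷ w ∷ ws) (uv , _)     zero    _ = uv
  nth-step d (u ∷ v ∷ [])     _            (suc i) (s≤s (s≤s ()))
  nth-step d (u ∷ v ∷ w ∷ ws) (_ , _ , nb) (suc i) (s≤s i<) = nth-step d (v ∷ w ∷ ws) nb i i<

  nth-turn : ∀ d xs → NonBacktracking xs → ∀ i → suc (suc i) < length xs → nth d xs i ≢ nth d xs (suc (suc i))
  nth-turn d (u ∷ [])         _             _       (s≤s ())
  nth-turn d (u ∷ v ∷ [])     _             i       (s≤s (s≤s ()))
  nth-turn d (u ∷ v ∷ w ∷ ws) (_ , u≢w , _) zero    _ = u≢w
  nth-turn d (u ∷ v ∷ w ∷ ws) (_ , _ , nb)  (suc i) (s≤s i<) = nth-turn d (v ∷ w ∷ ws) nb i i<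

  nth-last : ∀ d x ys → nth d (ys ++ x ∷ []) (length ys) ≡ x
  nth-last d x []       = refl
  nth-last d x (_ ∷ ys) = nth-last d x ys

  length-snoc : ∀ (x : V) ys → length (ys ++ x ∷ []) ≡ suc (length ys)
  length-snoc x []       = refl
  length-snoc x (_ ∷ ys) = cong suc (length-snoc x ys)

  -- The tool against colour conflicts: the walk has one edge more than `ys` has entries, so seven
  -- inner vertices give the eight edges that girth 9 still excludes. The bound is decided by
  -- computation.
  noClosedWalk : ∀ x ys {_ : True (length ys ≤? 7)} → ¬ NonBacktracking (x ∷ (ys ++ x ∷ []))
  noClosedWalk x ys {l≤7} nb = noReturn f L (≤-trans (≤-reflexive (length-snoc x ys)) (s≤s (toWitness l≤7)))
    (λ i i<L → nth-step x walk nb i (s≤s i<L)) (λ i i<L → nth-turn x walk nb i (s≤s i<L)) (suc (length ys)) (s≤s z≤n) 0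
    (≤-reflexive (trans (+-comm (suc (length ys)) 0) (sym (length-snoc x ys))))
    (sym (trans (cong f (+-comm (suc (length ys)) 0)) (nth-last x x ys)))
    where
    walk : List V
    walk = x ∷ (ys ++ x ∷ [])
    L : ℕ
    L = length (ys ++ x ∷ [])
    f : ℕ → V
    f = nth x walk

  -- Roots, links and rotations

  module Roots {k : ℕ} (w : Fin (suc k) → V) (w-inj : Injective _≡_ _≡_ w)
               (w-degree : ∀ i → k ≤ degree G (w i)) (large-root : ∀ v → suc k ≤ degree G v → ∃ λ i → w i ≡ v) where

    C : Set
    C = Fin (suc k)

    Root : V → Set
    Root v = ∃ λ i → w i ≡ v

    Root? : ∀ v → Dec (Root v)
    Root? v = any? λ i → w i ≟ v

    Link : V → Set
    Link u = ¬ Root u × ∃₂ λ i j → i ≢ j × u ~ w i × u ~ w j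

    Link? : ∀ u → Dec (Link u)
    Link? u = ¬? (Root? u) ×-dec any? λ i → any? λ j → ¬? (i ≟ j) ×-dec (u ~? w i) ×-dec (u ~? w j)

    Reaches : V → C → Set
    Reaches u l = ∃ λ a → ¬ Root a × u ~ a × a ~ w l

    Reaching : V → Set
    Reaching u = ∃ (Reaches u)

    Reaching? : ∀ u → Dec (Reaching u)
    Reaching? u = any? λ l → any? λ a → ¬? (Root? a) ×-dec (u ~? a) ×-dec (a ~? w l)

    Outer : V → Set
    Outer u = ¬ Root u × ∃ λ i → u ~ w i

    Constrained : V → Set
    Constrained u = Outer u × (Link u ⊎ Reaching u)

    Constrained? : ∀ u → Dec (Constrained u)
    Constrained? u = (¬? (Root? u) ×-dec any? λ i → u ~? w i) ×-dec (Link? u ⊎-dec Reaching? u)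

    HasSibling : V → Set
    HasSibling u = ∃₂ λ i v → v ≢ u × Link v × u ~ w i × v ~ w i

    HasSibling? : ∀ u → Dec (HasSibling u)
    HasSibling? u = any? λ i → any? λ v → ¬? (v ≟ u) ×-dec Link? v ×-dec (u ~? w i) ×-dec (v ~? w i)

    Private : C → V → Set
    Private i x = x ~ w i × ¬ Root x × ¬ Link x × Reaching x

    Private? : ∀ i x → Dec (Private i x)
    Private? i x = (x ~? w i) ×-dec ¬? (Root? x) ×-dec ¬? (Link? x) ×-dec Reaching? x

    abstract
      -- Fixes one private vertex per root, so that at most one joins the rotation there. If there
      -- is none, `w i` is a filler, which is not private since it is a root.
      representative : ∀ i → ∃ λ v → ∃ (Private i) → Private i v
      representative i with any? (Private? i)
      ... | yes (x , x-private) = x , λ _ → x-private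
      ... | no ¬private         = w i , λ p → contradiction p ¬private

    rep : C → V
    rep i = proj₁ (representative i)

    -- The links at w i together with, when a link without siblings is attached to w i, one private vertex:
    -- these are the vertices that exchange colours along the rotation around w i.
    Rotated : C → V → Set
    Rotated i v = v ~ w i × (Link v ⊎ v ≡ rep i × Private i v × ∃ λ u → Link u × u ~ w i × ¬ HasSibling u)

    Rotated? : ∀ i v → Dec (Rotated i v)
    Rotated? i v = (v ~? w i) ×-dec (Link? v ⊎-dec (v ≟ rep i) ×-dec Private? i v ×-dec
      any? λ u → Link? u ×-dec (u ~? w i) ×-dec ¬? (HasSibling? u))

    abstract
      rotationAround : ∀ i → Rotation (Rotated i)
      rotationAround i = rotation (Rotated i) (Rotated? i)

    module Rot i = Rotation (rotationAround i)

    next : C → V → V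
    next i = Rot.rotate i

    -- These are exactly the links for which no colour `l` meets the second condition of `far`.
    Encircled : V → Set
    Encircled u = Link u × (∀ l → ∃ λ i → u ~ w i × (l ≡ i ⊎ w l ~ w i))

    Encircled? : ∀ u → Dec (Encircled u)
    Encircled? u = Link? u ×-dec all? λ l → any? λ i → (u ~? w i) ×-dec ((l ≟ i) ⊎-dec (w l ~? w i))

    Lone : V → Set
    Lone u = Link u × ¬ Reaching u × ¬ HasSibling u

    Isolated : V → Set
    Isolated u = Lone u × (∀ i x → u ~ w i → ¬ Private i x)

    -- Encircled links and the sacrificed root

    root≢ : ∀ {i u} → ¬ Root u → w i ≢ u
    root≢ u∉ e = u∉ (_ , e)

    ≢root : ∀ {i u} → ¬ Root u → u ≢ w i
    ≢root u∉ e = u∉ (_ , sym e)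

    w≢ : ∀ {i j} → i ≢ j → w i ≢ w j
    w≢ i≢j e = i≢j (w-inj e)

    uniqueRoot : ∀ {u i j} → ¬ Root u → ¬ Link u → u ~ w i → u ~ w j → i ≡ j
    uniqueRoot {u} {i} {j} u∉ ¬link ui uj = decidable-stable (i ≟ j) λ i≢j → ¬link (u∉ , i , j , i≢j , ui , uj)

    reaches-avoids : ∀ {u l} → ¬ Root u → Reaches u l → ¬ u ~ w l
    reaches-avoids {u} {l} u∉ (a , a∉ , ua , al) ul =
      noClosedWalk (w l) (a ∷ u ∷ []) (~-sym al , root≢ u∉ , ~-sym ua , ≢root a∉ , ul)

    -- Take two roots at `u`. An encircled `v` is joined to both through roots in at most two steps,
    -- so `u ≢ v` would close a walk of at most 6 edges.
    encircled-unique : ∀ {u v} → Encircled u → Encircled v → u ≡ v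
    encircled-unique {u} {v} ((u∉ , i , j , i≢j , ui , uj) , _) ((v∉ , _) , v-enc) with u ≟ v | v-enc i | v-enc j
    ... | yes u≡v | _ | _ = u≡v
    ... | no u≢v | i′ , vi , inj₁ refl | j′ , vj , inj₁ refl = ⊥-elim (noClosedWalk v (w i ∷ u ∷ w j ∷ [])
      (vi , ≢-sym u≢v , ~-sym ui , w≢ i≢j , uj , u≢v , ~-sym vj))
    ... | no u≢v | i′ , vi , inj₁ refl | j′ , vj′ , inj₂ jj′ = ⊥-elim (noClosedWalk v (w i ∷ u ∷ w j ∷ w j′ ∷ [])
      (vi , ≢-sym u≢v , ~-sym ui , w≢ i≢j , uj , ≢root u∉ , jj′ , root≢ v∉ , ~-sym vj′))
    ... | no u≢v | i′ , vi′ , inj₂ ii′ | j′ , vj , inj₁ refl = ⊥-elim (noClosedWalk v (w i′ ∷ w i ∷ u ∷ w j ∷ [])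
      (vi′ , ≢root v∉ , ~-sym ii′ , root≢ u∉ , ~-sym ui , w≢ i≢j , uj , u≢v , ~-sym vj))
    ... | no u≢v | i′ , vi′ , inj₂ ii′ | j′ , vj′ , inj₂ jj′ = ⊥-elim (noClosedWalk v (w i′ ∷ w i ∷ u ∷ w j ∷ w j′ ∷ [])
      (vi′ , ≢root v∉ , ~-sym ii′ , root≢ u∉ , ~-sym ui , w≢ i≢j , uj , ≢root u∉ , jj′ , root≢ v∉ , ~-sym vj′))

    -- Adjacency to all `k + 1` roots would make `u` a root by its degree. A root `w l` that is not
    -- its neighbour must then be adjacent to a root `w i` at `u`.
    encircled-escape : ∀ {u} → Encircled u → ∃₂ λ i l → u ~ w i × w l ~ w i
    encircled-escape {u} ((u∉ , _) , enc) with any? (λ l → ¬? (u ~? w l))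
    ... | no all = contradiction (large-root u (injective⇒≤degree G u w-inj λ l → decidable-stable (u ~? w l) λ ¬ul → all (l , ¬ul))) u∉
    ... | yes (l , ¬ul) with enc l
    ...   | i , ui , inj₁ refl = contradiction ui ¬ul
    ...   | i , ui , inj₂ li   = i , l , ui , li

    -- An encircled link may take the colour `l` of a root adjacent to `w r`. Then `w r` sees `l`
    -- twice, and no other root wastes a colour.
    Sacrificed : C → Set
    Sacrificed r = ∀ {u} → Encircled u → ∃ λ l → u ~ w r × w l ~ w r

    abstract
      sacrificed : ∃ Sacrificed
      sacrificed with any? Encircled?
      -- Without an encircled link the condition is vacuous and any root will do.
      ... | no none = zero , λ e → contradiction (_ , e) none
      ... | yes (v , v-enc) with i , l , vi , li ← encircled-escape v-enc
          = i , λ e → l , subst (_~ w i) (encircled-unique v-enc e) vi , li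

    r : C
    r = proj₁ sacrificed

    -- Marked colours and their conflicts

    Stolen : C → V → Set
    Stolen i x = Rotated i x × ¬ Link x

    -- Reasons for giving u the colour l. The root w l is reached along u – a – w l (own), u – w i – x – w l (viaLink)
    -- or u – w i – x – a – w l (viaPrivate), where x = next i u and the vertices a, x are not roots.
    data Mark (u : V) (l : C) : Set where
      own        : Reaches u l → (∀ i → ¬ Stolen i u) → Mark u l
      viaLink    : ∀ {i} → Rotated i u → next i u ≢ u → Link (next i u) → i ≢ l → next i u ~ w l → Mark u l
      viaPrivate : ∀ {i} → Lone u → Rotated i u → Stolen i (next i u) → Reaches (next i u) l → Mark u l
      far        : Isolated u → (∀ i → u ~ w i → l ≢ i × ¬ w l ~ w i) → Mark u l
      sacrifice  : Isolated u → u ~ w r → w l ~ w r → Mark u l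

    next-adj : ∀ {i u} → Rotated i u → next i u ~ w i
    next-adj {i} u-rot = proj₁ (Rot.preserves i u-rot)

    stolen-private : ∀ {i x} → Stolen i x → Private i x
    stolen-private ((_ , inj₁ link) , ¬link)    = contradiction link ¬link
    stolen-private ((_ , inj₂ (_ , p , _)) , _) = p

    -- The path behind the mark and an edge from `w l` back to `u` would close a walk of at most 5
    -- edges; for `far` the claim is part of the mark.
    avoids-root : ∀ {u l} → ¬ Root u → Mark u l → ¬ u ~ w l
    avoids-root u∉ (own reach _) ul = reaches-avoids u∉ reach ul
    avoids-root {u} {l} u∉ (viaLink {i} u-rot moved (x∉ , _) i≢l xl) ul =
      noClosedWalk (w l) (next i u ∷ w i ∷ u ∷ [])
        (~-sym xl , w≢ (≢-sym i≢l) , next-adj u-rot , moved , ~-sym (proj₁ u-rot) , w≢ i≢l , ul)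
    avoids-root {u} {l} u∉ (viaPrivate {i} (link , _) u-rot x-stolen (a , a∉ , xa , al)) ul
      with xi , x∉ , ¬x-link , _ ← stolen-private x-stolen =
      noClosedWalk (w l) (a ∷ next i u ∷ w i ∷ u ∷ [])
        ( ~-sym al , root≢ x∉ , ~-sym xa , ≢root a∉ , xi , (λ e → ¬x-link (subst Link (sym e) link)) , ~-sym (proj₁ u-rot)
        , w≢ (λ i≡l → reaches-avoids x∉ (a , a∉ , xa , al) (subst (λ j → next i u ~ w j) i≡l xi)) , ul)
    avoids-root u∉ (far _ apart) ul = proj₁ (apart _ ul) refl
    avoids-root {u} {l} u∉ (sacrifice _ ur lr) ul =
      noClosedWalk u (w r ∷ w l ∷ []) (ur , ≢root u∉ , ~-sym lr , root≢ u∉ , ~-sym ul)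

    -- Otherwise `w i` would see the colour `l` at both `w l` and `u`. The walk closed through `w i`
    -- has at most 6 edges; only a `sacrifice` mark seen from `w r` escapes.
    avoids-second-root : ∀ {u l i} → i ≢ r → ¬ Root u → Mark u l → u ~ w i → ¬ w i ~ w l
    avoids-second-root {u} {l} {i} _ u∉ (own (a , a∉ , ua , al) _) ui il =
      noClosedWalk (w l) (a ∷ u ∷ w i ∷ []) (~-sym al , root≢ u∉ , ~-sym ua , ≢root a∉ , ui , ≢root u∉ , il)
    avoids-second-root {u} {l} {i} _ u∉ (viaLink {j} u-rot moved (x∉ , _) j≢l xl) ui il with j ≟ i
    ... | yes refl = noClosedWalk (w l) (next j u ∷ w j ∷ []) (~-sym xl , w≢ (≢-sym j≢l) , next-adj u-rot , ≢root x∉ , il)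
    ... | no j≢i   = noClosedWalk (w l) (next j u ∷ w j ∷ u ∷ w i ∷ [])
      (~-sym xl , w≢ (≢-sym j≢l) , next-adj u-rot , moved , ~-sym (proj₁ u-rot) , w≢ j≢i , ui , ≢root u∉ , il)
    avoids-second-root {u} {l} {i} _ u∉ (viaPrivate {j} (link , _) u-rot x-stolen (a , a∉ , xa , al)) ui il
      with xj , x∉ , ¬x-link , _ ← stolen-private x-stolen with j ≟ i
    ... | yes refl = noClosedWalk (w l) (a ∷ next j u ∷ w j ∷ [])
      (~-sym al , root≢ x∉ , ~-sym xa , ≢root a∉ , xj , ≢root x∉ , il)
    ... | no j≢i   = noClosedWalk (w l) (a ∷ next j u ∷ w j ∷ u ∷ w i ∷ [])
      ( ~-sym al , root≢ x∉ , ~-sym xa , ≢root a∉ , xj , (λ e → ¬x-link (subst Link (sym e) link))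
      , ~-sym (proj₁ u-rot) , w≢ j≢i , ui , ≢root u∉ , il)
    avoids-second-root _ u∉ (far _ apart) ui il = proj₂ (apart _ ui) (~-sym il)
    avoids-second-root {u} {l} {i} i≢r u∉ (sacrifice _ ur lr) ui il =
      noClosedWalk (w l) (w r ∷ u ∷ w i ∷ []) (lr , root≢ u∉ , ~-sym ur , w≢ (≢-sym i≢r) , ui , ≢root u∉ , il)

    reaching : ∀ {u v} → Outer v → u ~ v → Reaching u
    reaching {v = v} (v∉ , j , vj) uv = j , v , v∉ , uv , vj

    -- Marks `own` and `viaLink` on both sides close a walk of at most 7 edges. The other marks sit
    -- on links that are not reaching, and these have no outer neighbour.
    neighbours-differ : ∀ {u v l} → Outer u → Outer v → Mark u l → Mark v l → ¬ u ~ v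
    neighbours-differ {u} {v} {l} (u∉ , _) (v∉ , _) m@(own (a , a∉ , ua , al) _) m′@(own (b , b∉ , vb , bl) _) uv =
      noClosedWalk (w l) (a ∷ u ∷ v ∷ b ∷ [])
        ( ~-sym al , root≢ u∉ , ~-sym ua , (λ { refl → avoids-root v∉ m′ al }) , uv
        , (λ { refl → avoids-root u∉ m bl }) , vb , ≢root v∉ , bl)
    neighbours-differ {u} {v} {l} (u∉ , _) (v∉ , _) m@(viaLink {i} u-rot moved _ i≢l xl) m′@(own (b , b∉ , vb , bl) _) uv =
      noClosedWalk (w l) (next i u ∷ w i ∷ u ∷ v ∷ b ∷ [])
        ( ~-sym xl , w≢ (≢-sym i≢l) , next-adj u-rot , moved , ~-sym (proj₁ u-rot) , root≢ v∉ , uv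
        , (λ { refl → avoids-root u∉ m bl }) , vb , ≢root v∉ , bl)
    neighbours-differ u-out v-out m@(own _ _) m′@(viaLink _ _ _ _ _) uv = neighbours-differ v-out u-out m′ m (~-sym uv)
    neighbours-differ {u} {v} {l} (u∉ , _) (v∉ , _) (viaLink {i} u-rot moved _ i≢l xl) (viaLink {j} v-rot moved′ _ j≢l yl) uv =
      noClosedWalk (w l) (next i u ∷ w i ∷ u ∷ v ∷ w j ∷ next j v ∷ [])
        ( ~-sym xl , w≢ (≢-sym i≢l) , next-adj u-rot , moved , ~-sym (proj₁ u-rot) , root≢ v∉ , uv , ≢root u∉
        , proj₁ v-rot , ≢-sym moved′ , ~-sym (next-adj v-rot) , w≢ j≢l , yl)
    neighbours-differ u-out v-out (viaPrivate (_ , ¬reach , _) _ _ _) _ uv = ¬reach (reaching v-out uv)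
    neighbours-differ u-out v-out (far ((_ , ¬reach , _) , _) _) _ uv = ¬reach (reaching v-out uv)
    neighbours-differ u-out v-out (sacrifice ((_ , ¬reach , _) , _) _ _) _ uv = ¬reach (reaching v-out uv)
    neighbours-differ u-out v-out _ (viaPrivate (_ , ¬reach , _) _ _ _) uv = ¬reach (reaching u-out (~-sym uv))
    neighbours-differ u-out v-out _ (far ((_ , ¬reach , _) , _) _) uv = ¬reach (reaching u-out (~-sym uv))
    neighbours-differ u-out v-out _ (sacrifice ((_ , ¬reach , _) , _) _ _) uv = ¬reach (reaching u-out (~-sym uv))

    lone-sibling : ∀ {u v i} → Lone u → u ~ w i → v ~ w i → u ≢ v → ¬ Link v
    lone-sibling (_ , _ , ¬sib) ui vi u≢v v-link = ¬sib (_ , _ , ≢-sym u≢v , v-link , ui , vi)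

    mark-private : ∀ {v l i} → ¬ Root v → Mark v l → ¬ Link v → v ~ w i → Private i v
    mark-private v∉ (own reach _) ¬link vi = vi , v∉ , ¬link , _ , reach
    mark-private v∉ (viaLink v-rot _ _ _ _) ¬link vi
      with vj , _ , _ , reach ← stolen-private (v-rot , ¬link) = vi , v∉ , ¬link , reach
    mark-private v∉ (viaPrivate (link , _) _ _ _) ¬link _ = contradiction link ¬link
    mark-private v∉ (far ((link , _) , _) _) ¬link _ = contradiction link ¬link
    mark-private v∉ (sacrifice ((link , _) , _) _ _) ¬link _ = contradiction link ¬link

    -- A link `v` would be a sibling of `u`, and any other marked vertex at `w i` would be private;
    -- an isolated link admits neither. This settles every conflict of `far` and `sacrifice` at a
    -- common root.
    isolated-alone : ∀ {u v l i} → Isolated u → ¬ Root v → Mark v l → u ~ w i → v ~ w i → ¬ u ≢ v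
    isolated-alone (lone , none) v∉ m ui vi u≢v = none _ _ ui (mark-private v∉ m (lone-sibling lone ui vi u≢v) vi)

    own-viaLink : ∀ {u v l k} → ¬ Root u → ¬ Root v → u ≢ v → Reaches u l →
      ∀ {i} → Rotated i v → next i v ≢ v → Link (next i v) → i ≢ l → next i v ~ w l → u ~ w k → ¬ v ~ w k
    own-viaLink {u} {v} {l} {k} u∉ v∉ u≢v reach@(a , a∉ , ua , al) {i} v-rot moved _ i≢l xl uk vk with i ≟ k
    ... | yes refl = noClosedWalk (w l) (a ∷ u ∷ w k ∷ next k v ∷ [])
      ( ~-sym al , root≢ u∉ , ~-sym ua , ≢root a∉ , uk , (λ e → reaches-avoids u∉ reach (subst (_~ w l) (sym e) xl))
      , ~-sym (next-adj v-rot) , w≢ i≢l , xl)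
    ... | no i≢k = noClosedWalk (w l) (a ∷ u ∷ w k ∷ v ∷ w i ∷ next i v ∷ [])
      ( ~-sym al , root≢ u∉ , ~-sym ua , ≢root a∉ , uk , u≢v , ~-sym vk , w≢ (≢-sym i≢k) , proj₁ v-rot , ≢-sym moved
      , ~-sym (next-adj v-rot) , w≢ i≢l , xl)

    -- If `v` is rotated around a root other than `w k`, the closed walk has 8 edges and needs the
    -- full girth. At `w k` itself, `u` could be the very vertex whose colour `v` takes; the
    -- condition in `own` that `u` is not stolen prevents this.
    own-viaPrivate : ∀ {u v l k} → ¬ Root u → ¬ Root v → u ≢ v → Reaches u l → (∀ i → ¬ Stolen i u) →
      ∀ {i} → Lone v → Rotated i v → Stolen i (next i v) → Reaches (next i v) l → u ~ w k → ¬ v ~ w k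
    own-viaPrivate {u} {v} {l} {k} u∉ v∉ u≢v (a , a∉ , ua , al) kept {i} (link , _) v-rot x-stolen (b , b∉ , xb , bl) uk vk
      with xi , x∉ , ¬x-link , _ ← stolen-private x-stolen with i ≟ k
    ... | yes refl = noClosedWalk (w l) (a ∷ u ∷ w k ∷ next k v ∷ b ∷ [])
      ( ~-sym al , root≢ u∉ , ~-sym ua , ≢root a∉ , uk , (λ e → kept k (subst (Stolen k) (sym e) x-stolen))
      , ~-sym xi , root≢ b∉ , xb , ≢root x∉ , bl)
    ... | no i≢k = noClosedWalk (w l) (a ∷ u ∷ w k ∷ v ∷ w i ∷ next i v ∷ b ∷ [])
      ( ~-sym al , root≢ u∉ , ~-sym ua , ≢root a∉ , uk , u≢v , ~-sym vk , w≢ (≢-sym i≢k) , proj₁ v-rot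
      , (λ e → ¬x-link (subst Link e link)) , ~-sym xi , root≢ b∉ , xb , ≢root x∉ , bl)

    -- If v exchanges colours around a root w k shared with the lone link u, then v is private,
    -- so the link that v copies is the only one at w k, namely u itself.
    viaLink-viaPrivate : ∀ {u v l k} → ¬ Root v → u ≢ v → Lone u → Mark u l →
      ∀ {i} → Rotated i v → Link (next i v) → next i v ~ w l → u ~ w k → ¬ v ~ w k
    viaLink-viaPrivate {u} {v} {l} {k} v∉ u≢v lone m {i} v-rot x-link xl uk vk
      with refl ← uniqueRoot v∉ (lone-sibling lone uk vk u≢v) (proj₁ v-rot) vk
      = lone-sibling lone uk (next-adj v-rot) (λ u≡x → avoids-root (proj₁ (proj₁ lone)) m (subst (_~ w l) (sym u≡x) xl)) x-link

    -- If both rotate around `w k`, injectivity gives them different links. If one does, its link is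
    -- adjacent to `w l` and so differs from the other vertex. If neither does, the closed walk has
    -- 8 edges.
    viaLink-viaLink : ∀ {u v l k} → ¬ Root u → ¬ Root v → u ≢ v → Mark u l → Mark v l →
      ∀ {i j} → Rotated i u → next i u ≢ u → Link (next i u) → i ≢ l → next i u ~ w l →
      Rotated j v → next j v ≢ v → Link (next j v) → j ≢ l → next j v ~ w l → u ~ w k → ¬ v ~ w k
    viaLink-viaLink {u} {v} {l} {k} u∉ v∉ u≢v mu mv {i} {j} u-rot u-moved (x∉ , _) i≢l xl v-rot v-moved (y∉ , _) j≢l yl uk vk
      with i ≟ k | j ≟ k
    ... | yes refl | yes refl = noClosedWalk (w l) (next k u ∷ w k ∷ next k v ∷ [])
      ( ~-sym xl , w≢ (≢-sym i≢l) , next-adj u-rot , (λ e → u≢v (Rot.injective k u-rot v-rot e))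
      , ~-sym (next-adj v-rot) , w≢ j≢l , yl)
    ... | yes refl | no j≢k = noClosedWalk (w l) (next k u ∷ w k ∷ v ∷ w j ∷ next j v ∷ [])
      ( ~-sym xl , w≢ (≢-sym i≢l) , next-adj u-rot , (λ e → avoids-root v∉ mv (subst (_~ w l) e xl)) , ~-sym vk
      , w≢ (≢-sym j≢k) , proj₁ v-rot , ≢-sym v-moved , ~-sym (next-adj v-rot) , w≢ j≢l , yl)
    ... | no i≢k | yes refl = noClosedWalk (w l) (next i u ∷ w i ∷ u ∷ w k ∷ next k v ∷ [])
      ( ~-sym xl , w≢ (≢-sym i≢l) , next-adj u-rot , u-moved , ~-sym (proj₁ u-rot) , w≢ i≢k , uk
      , (λ e → avoids-root u∉ mu (subst (_~ w l) (sym e) yl)) , ~-sym (next-adj v-rot) , w≢ j≢l , yl)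
    ... | no i≢k | no j≢k = noClosedWalk (w l) (next i u ∷ w i ∷ u ∷ w k ∷ v ∷ w j ∷ next j v ∷ [])
      ( ~-sym xl , w≢ (≢-sym i≢l) , next-adj u-rot , u-moved , ~-sym (proj₁ u-rot) , w≢ i≢k , uk , u≢v , ~-sym vk
      , w≢ (≢-sym j≢k) , proj₁ v-rot , ≢-sym v-moved , ~-sym (next-adj v-rot) , w≢ j≢l , yl)

    siblings-differ : ∀ {u v l k} → ¬ Root u → ¬ Root v → Mark u l → Mark v l → u ~ w k → v ~ w k → ¬ u ≢ v
    siblings-differ {u} {v} {l} {k} u∉ v∉ (own (a , a∉ , ua , al) _) (own (b , b∉ , vb , bl) _) uk vk u≢v =
      noClosedWalk (w l) (a ∷ u ∷ w k ∷ v ∷ b ∷ [])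
        (~-sym al , root≢ u∉ , ~-sym ua , ≢root a∉ , uk , u≢v , ~-sym vk , root≢ b∉ , vb , ≢root v∉ , bl)
    siblings-differ u∉ v∉ (own reach _) (viaLink rot moved link i≢l xl) uk vk u≢v =
      own-viaLink u∉ v∉ u≢v reach rot moved link i≢l xl uk vk
    siblings-differ u∉ v∉ (viaLink rot moved link i≢l xl) (own reach _) uk vk u≢v =
      own-viaLink v∉ u∉ (≢-sym u≢v) reach rot moved link i≢l xl vk uk
    siblings-differ u∉ v∉ (own reach kept) (viaPrivate lone rot stolen reach′) uk vk u≢v =
      own-viaPrivate u∉ v∉ u≢v reach kept lone rot stolen reach′ uk vk
    siblings-differ u∉ v∉ (viaPrivate lone rot stolen reach′) (own reach kept) uk vk u≢v =
      own-viaPrivate v∉ u∉ (≢-sym u≢v) reach kept lone rot stolen reach′ vk uk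
    siblings-differ u∉ v∉ m@(viaLink rot moved link i≢l xl) m′@(viaLink rot′ moved′ link′ j≢l yl) uk vk u≢v =
      viaLink-viaLink u∉ v∉ u≢v m m′ rot moved link i≢l xl rot′ moved′ link′ j≢l yl uk vk
    siblings-differ u∉ v∉ (viaLink rot moved link i≢l xl) m@(viaPrivate lone _ _ _) uk vk u≢v =
      viaLink-viaPrivate u∉ (≢-sym u≢v) lone m rot link xl vk uk
    siblings-differ u∉ v∉ m@(viaPrivate lone _ _ _) (viaLink rot moved link i≢l xl) uk vk u≢v =
      viaLink-viaPrivate v∉ u≢v lone m rot link xl uk vk
    siblings-differ u∉ v∉ (viaPrivate lone _ _ _) (viaPrivate (link , _) _ _ _) uk vk u≢v = lone-sibling lone uk vk u≢v link
    siblings-differ u∉ v∉ (far isolated _) m uk vk u≢v = isolated-alone isolated v∉ m uk vk u≢v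
    siblings-differ u∉ v∉ (sacrifice isolated _ _) m uk vk u≢v = isolated-alone isolated v∉ m uk vk u≢v
    siblings-differ u∉ v∉ m (far isolated _) uk vk u≢v = isolated-alone isolated u∉ m vk uk (≢-sym u≢v)
    siblings-differ u∉ v∉ m (sacrifice isolated _ _) uk vk u≢v = isolated-alone isolated u∉ m vk uk (≢-sym u≢v)

    -- Every constrained vertex has a mark

    otherRoot : ∀ {x} → Link x → ∀ i → ∃ λ l → i ≢ l × x ~ w l
    otherRoot (_ , j , j′ , j≢j′ , xj , xj′) i with i ≟ j
    ... | yes refl = j′ , j≢j′ , xj′
    ... | no i≢j   = j , i≢j , xj

    moved : ∀ {i u v} → Rotated i u → Rotated i v → v ≢ u → next i u ≢ u
    moved {i} u-rot v-rot v≢u e = v≢u (Rot.moves i u-rot v-rot e)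

    markViaLink : ∀ {i u} → Rotated i u → next i u ≢ u → Link (next i u) → ∃ (Mark u)
    markViaLink {i} u-rot u-moved x-link with l , i≢l , xl ← otherRoot x-link i = l , viaLink u-rot u-moved x-link i≢l xl

    -- The representative is the only non-link in its rotation. A link is rotated there too, so `u`
    -- moves and its image is a link, whose other root supplies the colour.
    markStolen : ∀ {i u} → Stolen i u → ∃ (Mark u)
    markStolen ((_ , inj₁ link) , ¬link) = contradiction link ¬link
    markStolen {i} {u} (u-rot@(ui , inj₂ (u≡rep , _ , v , v-link , vi , _)) , ¬link) with Rot.preserves i u-rot
    ... | _ , inj₁ x-link      = markViaLink u-rot (moved u-rot (vi , inj₁ v-link) v≢u) x-link
      where v≢u = λ e → ¬link (subst Link e v-link)
    ... | _ , inj₂ (x≡rep , _) = contradiction (trans x≡rep (sym u≡rep)) (moved u-rot (vi , inj₁ v-link) v≢u)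
      where v≢u = λ e → ¬link (subst Link e v-link)

    -- A private vertex joins a rotation only beside a link without siblings. With two links at
    -- `w i` there is none, so the image of `u` is another link.
    markSibling : ∀ {u} → Link u → HasSibling u → ∃ (Mark u)
    markSibling {u} u-link (i , v , v≢u , v-link , ui , vi) with Rot.preserves i (ui , inj₁ u-link)
    ... | _ , inj₁ x-link = markViaLink (ui , inj₁ u-link) (moved (ui , inj₁ u-link) (vi , inj₁ v-link) v≢u) x-link
    ... | _ , inj₂ (_ , _ , t , t-link , ti , ¬sib) with u ≟ t
    ...   | yes refl = contradiction (i , v , v≢u , v-link , ti , vi) ¬sib
    ...   | no u≢t   = contradiction (i , u , u≢t , u-link , ti , ui) ¬sib

    -- The representative at `w i` is rotated with `u`, so `u` moves. A link as image would be a
    -- sibling, so the image is private and hands over a colour that it reaches.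
    markPrivate : ∀ {u i x} → Lone u → u ~ w i → Private i x → ∃ (Mark u)
    markPrivate {u} {i} {x} lone@(u-link , _ , ¬sib) ui x-private
      with rep-private ← proj₂ (representative i) (x , x-private) with Rot.preserves i (ui , inj₁ u-link)
    ... | xi , inj₁ x-link = contradiction (i , _ , u-moves , x-link , ui , xi) ¬sib
      where
      u-moves : next i u ≢ u
      u-moves = moved (ui , inj₁ u-link) (proj₁ rep-private , inj₂ (refl , rep-private , u , u-link , ui , ¬sib))
        (λ e → proj₁ (proj₂ (proj₂ rep-private)) (subst Link (sym e) u-link))
    ... | rot@(_ , inj₂ (_ , (_ , _ , ¬x-link , l , reach) , _)) = l , viaPrivate lone (ui , inj₁ u-link) (rot , ¬x-link) reach

    -- No other marked vertex competes at the roots of `u`, so `l` only has to avoid these roots and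
    -- the roots adjacent to them. If every colour fails, `u` is encircled and the choice of `r`
    -- supplies one.
    markIsolated : ∀ {u} → Isolated u → ∃ (Mark u)
    markIsolated {u} isolated@((u-link , _) , _)
      with any? (λ l → all? λ i → (u ~? w i) →-dec (¬? (l ≟ i) ×-dec ¬? (w l ~? w i)))
    ... | yes (l , apart) = l , far isolated apart
    ... | no none = sacrificeMark (proj₂ sacrificed (u-link , near))
      where
      sacrificeMark : (∃ λ l → u ~ w r × w l ~ w r) → ∃ (Mark u)
      sacrificeMark (l , ur , lr) = l , sacrifice isolated ur lr
      near : ∀ l → ∃ λ i → u ~ w i × (l ≡ i ⊎ w l ~ w i)
      near l = decidable-stable (any? λ i → (u ~? w i) ×-dec ((l ≟ i) ⊎-dec (w l ~? w i)))
        λ apart → none (l , λ i ui → (λ e → apart (i , ui , inj₁ e)) , λ li → apart (i , ui , inj₂ li))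

    -- Stolen vertices come first because `own` excludes them. Once `u` is known to reach nothing,
    -- it can only be a link.
    mark : ∀ {u} → Constrained u → ∃ (Mark u)
    mark {u} (_ , kind) with any? (λ i → Rotated? i u ×-dec ¬? (Link? u))
    ... | yes (i , u-stolen) = markStolen u-stolen
    ... | no kept with Reaching? u
    ...   | yes (l , reach) = l , own reach λ i s → kept (i , s)
    ...   | no ¬reach with [ id , (λ reach → contradiction reach ¬reach) ]′ kind | HasSibling? u
    ...     | u-link | yes sib = markSibling u-link sib
    ...     | u-link | no ¬sib with any? (λ i → (u ~? w i) ×-dec any? (Private? i))
    ...       | yes (i , ui , x , x-private) = markPrivate (u-link , ¬reach , ¬sib) ui x-private
    ...       | no none = markIsolated ((u-link , ¬reach , ¬sib) , λ i x ui p → none (i , ui , x , p))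

    -- Partial colourings

    record Partial : Set where
      field
        col    : V → Maybe C
        proper : ∀ {u v l} → col u ≡ just l → col v ≡ just l → ¬ u ~ v
        rooted : ∀ i → col (w i) ≡ just i
    open Partial

    _⊑_ : Partial → Partial → Set
    p ⊑ q = ∀ u l → col p u ≡ just l → col q u ≡ just l

    module Paint (p : Partial) (u : V) (l : C) (blank : col p u ≡ nothing) (fresh : ∀ v → u ~ v → col p v ≢ just l) where

      newCol : V → Maybe C
      newCol v with v ≟ u
      ... | yes _ = just l
      ... | no _  = col p v

      new-here : newCol u ≡ just l
      new-here with u ≟ u
      ... | yes _  = refl
      ... | no u≢u = contradiction refl u≢u

      extends : ∀ v j → col p v ≡ just j → newCol v ≡ just j
      extends v j e with v ≟ u
      ... | yes refl = contradiction (trans (sym blank) e) λ ()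
      ... | no _     = e

      coloured : ∀ {v j} → newCol v ≡ just j → (v ≡ u × j ≡ l) ⊎ col p v ≡ just j
      coloured {v} e with v ≟ u
      ... | yes v≡u = inj₁ (v≡u , sym (just-injective e))
      ... | no _    = inj₂ e

      blank-before : ∀ {v} → newCol v ≡ nothing → col p v ≡ nothing
      blank-before {v} e with v ≟ u
      ... | no _ = e

      painted : Partial
      painted = record { col = newCol ; proper = (λ {v} {v′} → proper′ {v} {v′}) ; rooted = λ i → extends _ _ (rooted p i) }
        where
        proper′ : ∀ {v v′ j} → newCol v ≡ just j → newCol v′ ≡ just j → ¬ v ~ v′
        proper′ {v} {v′} e e′ vv′ with coloured {v} e | coloured {v′} e′
        ... | inj₁ (refl , refl) | inj₁ (refl , _) = ~⇒≢ vv′ refl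
        ... | inj₁ (refl , refl) | inj₂ old        = fresh _ vv′ old
        ... | inj₂ old | inj₁ (refl , refl)        = fresh _ (~-sym vv′) old
        ... | inj₂ old | inj₂ old′                 = proper p old old′ vv′

    blank-nonroot : ∀ p {u} → col p u ≡ nothing → ¬ Root u
    blank-nonroot p blank (i , refl) = contradiction (trans (sym blank) (rooted p i)) λ ()

    root-colour : ∀ p {i l} → col p (w i) ≡ just l → i ≡ l
    root-colour p {i} e = just-injective (trans (sym (rooted p i)) e)

    -- Since the coloured neighbours of w i (i ≢ r) have distinct colours, none of them wastes a colour w i needs.
    record Balanced (p : Partial) : Set where
      field
        unconstrained : ∀ {u} → col p u ≡ nothing → ¬ Constrained u
        supported     : ∀ {u l} → col p u ≡ just l → Root u ⊎ ∃ λ i → u ~ w i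
        rainbow       : ∀ {i u v l} → i ≢ r → u ~ w i → v ~ w i → col p u ≡ just l → col p v ≡ just l → u ≡ v
    open Balanced

    -- The initial colouring

    data Start (u : V) : Maybe C → Set where
      atRoot : ∀ {i} → w i ≡ u → Start u (just i)
      marked : ∀ {l} → Outer u → Mark u l → Start u (just l)
      blank  : ¬ Root u → ¬ Constrained u → Start u nothing

    abstract
      start : ∀ u → ∃ (Start u)
      start u with Root? u | Constrained? u
      ... | yes (i , e) | _     = just i , atRoot e
      ... | no u∉       | yes c = just (proj₁ (mark c)) , marked (proj₁ c) (proj₂ (mark c))
      ... | no u∉       | no ¬c = nothing , blank u∉ ¬c

    startCol : V → Maybe C
    startCol u = proj₁ (start u)

    started : ∀ {u l} → startCol u ≡ just l → w l ≡ u ⊎ (Outer u × Mark u l)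
    started {u} e with startCol u | proj₂ (start u)
    started refl | _ | atRoot e     = inj₁ e
    started refl | _ | marked out m = inj₂ (out , m)

    initial : Partial
    initial = record { col = startCol ; proper = proper′ ; rooted = rooted′ }
      where
      proper′ : ∀ {u v l} → startCol u ≡ just l → startCol v ≡ just l → ¬ u ~ v
      proper′ e e′ uv with started e | started e′
      ... | inj₁ refl | inj₁ refl             = ~⇒≢ uv refl
      ... | inj₁ refl | inj₂ ((v∉ , _) , m)   = avoids-root v∉ m (~-sym uv)
      ... | inj₂ ((u∉ , _) , m) | inj₁ refl   = avoids-root u∉ m uv
      ... | inj₂ (u-out , m) | inj₂ (v-out , m′) = neighbours-differ u-out v-out m m′ uv
      rooted′ : ∀ i → startCol (w i) ≡ just i
      rooted′ i with startCol (w i) | proj₂ (start (w i))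
      ... | _ | atRoot e           = cong just (w-inj e)
      ... | _ | marked (i∉ , _) _  = contradiction (i , refl) i∉
      ... | _ | blank i∉ _         = contradiction (i , refl) i∉

    initial-balanced : Balanced initial
    initial-balanced = record { unconstrained = unconstrained′ ; supported = supported′ ; rainbow = rainbow′ }
      where
      unconstrained′ : ∀ {u} → startCol u ≡ nothing → ¬ Constrained u
      unconstrained′ {u} e with startCol u | proj₂ (start u)
      unconstrained′ refl | _ | blank _ ¬c = ¬c
      supported′ : ∀ {u l} → startCol u ≡ just l → Root u ⊎ ∃ λ i → u ~ w i
      supported′ e with started e
      ... | inj₁ wl≡u        = inj₁ (_ , wl≡u)
      ... | inj₂ ((_ , i) , _) = inj₂ i
      rainbow′ : ∀ {i u v l} → i ≢ r → u ~ w i → v ~ w i → startCol u ≡ just l → startCol v ≡ just l → u ≡ v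
      rainbow′ {i} {u} {v} i≢r ui vi e e′ with started e | started e′
      ... | inj₁ refl | inj₁ refl = refl
      -- Only a root and a marked vertex can share a colour around `w r`, hence `i ≢ r`.
      ... | inj₁ refl | inj₂ ((v∉ , _) , m) = contradiction (~-sym ui) (avoids-second-root i≢r v∉ m vi)
      ... | inj₂ ((u∉ , _) , m) | inj₁ refl = contradiction (~-sym vi) (avoids-second-root i≢r u∉ m ui)
      ... | inj₂ ((u∉ , _) , m) | inj₂ ((v∉ , _) , m′) =
        decidable-stable (u ≟ v) (siblings-differ u∉ v∉ m m′ ui vi)

    -- Serving all colours to the roots

    Served : C → C → Partial → Set
    Served i l p = i ≢ r → l ≢ i → ∃ λ u → w i ~ u × col p u ≡ just l

    -- Otherwise the colours of k neighbours of w i, together with i and l, would be k + 2 distinct colours.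
    blankNeighbour : ∀ p → Balanced p → ∀ {i l} → i ≢ r → l ≢ i → ¬ (∃ λ u → w i ~ u × col p u ≡ just l) →
      ∃ λ u → w i ~ u × col p u ≡ nothing
    blankNeighbour p bal {i} {l} i≢r l≢i unserved with any? (λ u → (w i ~? u) ×-dec ≡-dec _≟_ (col p u) nothing)
    ... | yes found = found
    ... | no full with f , f-inj , f-adj ← neighbours G (w i) (w-degree i) = contradiction (injective⇒≤ colours-inj) 1+n≰n
      where
      colourOf : ∀ u → w i ~ u → ∃ λ j → col p u ≡ just j
      colourOf u iu with col p u in e
      ... | just j  = j , refl
      ... | nothing = contradiction (u , iu , e) full
      colour : Fin k → C
      colour t = proj₁ (colourOf (f t) (f-adj t))
      colour-inj : Injective _≡_ _≡_ colour
      colour-inj {s} {t} e = f-inj (rainbow bal i≢r (~-sym (f-adj s)) (~-sym (f-adj t))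
        (proj₂ (colourOf (f s) (f-adj s))) (trans (proj₂ (colourOf (f t) (f-adj t))) (cong just (sym e))))
      colours-inj : Injective _≡_ _≡_ (i ∷ᶠ (l ∷ᶠ colour))
      colours-inj = ∷ᶠ-injective i
        (∷ᶠ-injective l colour-inj λ t e → unserved (f t , f-adj t , trans (proj₂ (colourOf (f t) (f-adj t))) (cong just e)))
        λ { zero → l≢i
          ; (suc t) e → proper p (rooted p i) (trans (proj₂ (colourOf (f t) (f-adj t))) (cong just e)) (f-adj t) }

    -- A blank neighbour of `w i` is unconstrained, so `w i` is its only coloured neighbour and `l`
    -- is free. It touches no other root, and `w i` lacks `l`, so painting it keeps the balance.
    serve : ∀ i l (s : ∃ Balanced) → ∃ λ (t : ∃ Balanced) → proj₁ s ⊑ proj₁ t × Served i l (proj₁ t)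
    serve i l (p , bal) with i ≟ r | l ≟ i | any? (λ u → (w i ~? u) ×-dec ≡-dec _≟_ (col p u) (just l))
    ... | yes i≡r | _ | _ = (p , bal) , (λ _ _ → id) , λ i≢r → contradiction i≡r i≢r
    ... | no _ | yes l≡i | _ = (p , bal) , (λ _ _ → id) , λ _ l≢i → contradiction l≡i l≢i
    ... | no _ | no _ | yes served = (p , bal) , (λ _ _ → id) , λ _ _ → served
    ... | no i≢r | no l≢i | no unserved with u , iu , u-blank ← blankNeighbour p bal i≢r l≢i unserved
      = (painted , bal′) , extends , λ _ _ → u , iu , new-here
      where
      ui : u ~ w i
      ui = ~-sym iu
      u∉ : ¬ Root u
      u∉ = blank-nonroot p u-blank
      ¬u-link : ¬ Link u
      ¬u-link link = unconstrained bal u-blank ((u∉ , i , ui) , inj₁ link)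
      fresh : ∀ v → u ~ v → col p v ≢ just l
      fresh v uv e with Root? v
      ... | yes (j , refl) = l≢i (trans (sym (root-colour p e)) (uniqueRoot u∉ ¬u-link uv ui))
      ... | no v∉ with supported bal e
      ...   | inj₁ v∈       = v∉ v∈
      ...   | inj₂ (j , vj) = unconstrained bal u-blank ((u∉ , i , ui) , inj₂ (j , v , v∉ , uv , vj))
      open Paint p u l u-blank fresh
      bal′ : Balanced painted
      bal′ = record { unconstrained = λ {v} → unconstrained bal ∘ blank-before {v} ; supported = λ {v} → supported′ {v} ; rainbow = λ {j} {v} {v′} → rainbow′ {j} {v} {v′} }
        where
        supported′ : ∀ {v j} → newCol v ≡ just j → Root v ⊎ ∃ λ i → v ~ w i
        supported′ {v} e with coloured {v} e
        ... | inj₁ (refl , _) = inj₂ (i , ui)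
        ... | inj₂ old        = supported bal old
        rainbow′ : ∀ {j v v′ l} → j ≢ r → v ~ w j → v′ ~ w j → newCol v ≡ just l → newCol v′ ≡ just l → v ≡ v′
        rainbow′ {j} {v} {v′} j≢r vj v′j e e′ with coloured {v} e | coloured {v′} e′
        ... | inj₁ (refl , refl) | inj₁ (refl , _) = refl
        ... | inj₂ old | inj₂ old′ = rainbow bal j≢r vj v′j old old′
        ... | inj₁ (refl , refl) | inj₂ old′ with refl ← uniqueRoot u∉ ¬u-link vj ui = contradiction (_ , ~-sym v′j , old′) unserved
        ... | inj₂ old | inj₁ (refl , refl) with refl ← uniqueRoot u∉ ¬u-link v′j ui = contradiction (_ , ~-sym vj , old) unserved

    served-mono : ∀ {i l p q} → p ⊑ q → Served i l p → Served i l q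
    served-mono p⊑q served i≢r l≢i with u , iu , e ← served i≢r l≢i = u , iu , p⊑q _ _ e

    ⊑-refl : ∀ {p} → p ⊑ p
    ⊑-refl _ _ = id

    ⊑-trans : ∀ {p q s} → p ⊑ q → q ⊑ s → p ⊑ s
    ⊑-trans p⊑q q⊑s u l = q⊑s u l ∘ p⊑q u l

    serveAll : ∃ λ p → ∀ i l → Served i l p
    serveAll = proj₁ (proj₁ all) , proj₂ (proj₂ all)
      where
      _⊑ᵇ_ : ∃ Balanced → ∃ Balanced → Set
      s ⊑ᵇ t = proj₁ s ⊑ proj₁ t
      ⊑ᵇ-refl : ∀ {s} → s ⊑ᵇ s
      ⊑ᵇ-refl {p , _} = ⊑-refl {p}
      ⊑ᵇ-trans : ∀ {s t u} → s ⊑ᵇ t → t ⊑ᵇ u → s ⊑ᵇ u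
      ⊑ᵇ-trans {p , _} {q , _} {q′ , _} = ⊑-trans {p} {q} {q′}
      mono : ∀ i l {s t} → s ⊑ᵇ t → Served i l (proj₁ s) → Served i l (proj₁ t)
      mono i l {p , _} {q , _} = served-mono {i} {l} {p} {q}
      serveRoot : ∀ i s → ∃ λ t → s ⊑ᵇ t × (∀ l → Served i l (proj₁ t))
      serveRoot i = perform _⊑ᵇ_ (λ {s} → ⊑ᵇ-refl {s}) (λ {s} {t} {u} → ⊑ᵇ-trans {s} {t} {u}) (suc k)
        (λ l s → Served i l (proj₁ s)) (λ l {s} {t} → mono i l {s} {t}) (serve i)
      unserved : ∃ Balanced
      unserved = initial , initial-balanced
      all : ∃ λ t → unserved ⊑ᵇ t × (∀ i l → Served i l (proj₁ t))
      all = perform _⊑ᵇ_ (λ {s} → ⊑ᵇ-refl {s}) (λ {s} {t} {u} → ⊑ᵇ-trans {s} {t} {u}) (suc k)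
        (λ i s → ∀ l → Served i l (proj₁ s)) (λ i {s} {t} s⊑t d l → mono i l {s} {t} s⊑t (d l)) serveRoot unserved

    -- Greedy completion

    colourVertex : ∀ u p → ∃ λ q → p ⊑ q × ∃ λ l → col q u ≡ just l
    colourVertex u p with col p u in e
    ... | just l  = p , (λ _ _ → id) , l , e
    ... | nothing with any? (λ l → ¬? (any? λ v → (u ~? v) ×-dec ≡-dec _≟_ (col p v) (just l)))
    ...   | yes (l , free) = painted , extends , l , new-here
      where open Paint p u l e (λ v uv vl → free (v , uv , vl))
    -- All `k + 1` colours occur around `u`, so its degree makes it a root, and roots are never
    -- blank.
    ...   | no none = contradiction (large-root u (injective⇒≤degree G u f-inj λ l → proj₁ (proj₂ (user l)))) (blank-nonroot p e)
      where
      user : ∀ l → ∃ λ v → u ~ v × col p v ≡ just l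
      user l = decidable-stable (any? λ v → (u ~? v) ×-dec ≡-dec _≟_ (col p v) (just l)) λ ¬used → none (l , ¬used)
      f-inj : Injective _≡_ _≡_ (proj₁ ∘ user)
      f-inj {l} {l′} e′ = just-injective (trans (sym (proj₂ (proj₂ (user l)))) (trans (cong (col p) e′) (proj₂ (proj₂ (user l′)))))

    -- Serving is inherited by extensions, so after the greedy completion each `w i` with `i ≢ r` is
    -- still a b-vertex, and only the class `r` is left to `mergeColour`.
    hasBColoring : HasBColoring G (suc k) ⊎ HasBColoring G k
    hasBColoring with p , served ← serveAll
      with q , p⊑q , total ← perform _⊑_ (λ {p} → ⊑-refl {p}) (λ {p} {q} {s} → ⊑-trans {p} {q} {s}) n (λ u p → ∃ λ l → col p u ≡ just l)
                               (λ { u p⊑q (l , e) → l , p⊑q _ _ e }) colourVertex p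
      = mergeColour G c c-proper r λ i i≢r → w i , at-root i , λ j j≢ → sees i i≢r j (λ j≡i → j≢ (trans j≡i (sym (at-root i))))
      where
      c : V → C
      c u = proj₁ (total u)
      c-proper : Proper G c
      c-proper u v uv e = proper q (proj₂ (total u)) (trans (proj₂ (total v)) (cong just (sym e))) uv
      agrees : ∀ {u l} → col q u ≡ just l → c u ≡ l
      agrees {u} e = just-injective (trans (sym (proj₂ (total u))) e)
      at-root : ∀ i → c (w i) ≡ i
      at-root i = agrees (rooted q i)
      sees : ∀ i → i ≢ r → ∀ j → j ≢ i → Σ V λ u → w i ~ u × c u ≡ j
      sees i i≢r j j≢i with u , iu , e ← served i j i≢r j≢i = u , iu , agrees (p⊑q _ _ e)

-- Choosing the roots

record RootSystem (G : Graph) (k : ℕ) : Set where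
  open Graph G using (n)
  field
    root      : Fin (suc k) → Fin n
    injective : Injective _≡_ _≡_ root
    dense     : ∀ i → k ≤ degree G (root i)

-- A missing vertex of degree above `k` replaces a root of degree `k`, so the roots of larger degree
-- are never lost.
rootSystem : ∀ (G : Graph) {k} → IsMNumber G (suc k) → Σ (RootSystem G k) λ s →
  ∀ v → suc k ≤ degree G v → ∃ λ i → RootSystem.root s i ≡ v
rootSystem G {k} ((f , f-inj , f-dense) , maximal) = proj₁ saturated , proj₂ (proj₂ saturated)
  where
  open Graph G using (n)
  open RootSystem
  Done : Fin n → RootSystem G k → Set
  Done v s = suc k ≤ degree G v → ∃ λ i → root s i ≡ v
  _⊑_ : RootSystem G k → RootSystem G k → Set
  s ⊑ t = ∀ v → suc k ≤ degree G v → (∃ λ i → root s i ≡ v) → ∃ λ i → root t i ≡ v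
  step : ∀ v s → ∃ λ t → s ⊑ t × Done v t
  step v s with suc k ≤? degree G v | any? (λ i → root s i ≟ v)
  ... | no ¬large | _       = s , (λ _ _ → id) , λ large → contradiction large ¬large
  ... | yes _     | yes v∈  = s , (λ _ _ → id) , λ _ → v∈
  ... | yes large | no v∉ with any? (λ i → ¬? (suc k ≤? degree G (root s i)))
  -- Here `v` and the roots would be `k + 2` vertices of degree at least `k + 1`, against the
  -- maximality of `k + 1`.
  ...   | no all-large = contradiction (maximal (suc (suc k))
            ((v ∷ᶠ root s) , ∷ᶠ-injective v (injective s) (λ i e → v∉ (i , e))
            , λ { zero → large ; (suc i) → decidable-stable (suc k ≤? degree G (root s i)) λ ¬l → all-large (i , ¬l) })) 1+n≰n
  ...   | yes (i , i-small) = t , s⊑t , λ _ → i , at-i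
    where
    swapped : Fin (suc k) → Fin n
    swapped j with j ≟ i
    ... | yes _ = v
    ... | no _  = root s j
    at-i : swapped i ≡ v
    at-i with i ≟ i
    ... | yes _  = refl
    ... | no i≢i = contradiction refl i≢i
    t : RootSystem G k
    t = record { root = swapped ; injective = inj ; dense = dense′ }
      where
      inj : Injective _≡_ _≡_ swapped
      inj {j} {j′} e with j ≟ i | j′ ≟ i
      ... | yes refl | yes refl = refl
      ... | yes _ | no _        = contradiction (j′ , sym e) v∉
      ... | no _ | yes _        = contradiction (j , e) v∉
      ... | no _ | no _         = injective s e
      dense′ : ∀ j → k ≤ degree G (swapped j)
      dense′ j with j ≟ i
      ... | yes _ = ≤-trans (n≤1+n k) large
      ... | no _  = dense s j
    s⊑t : s ⊑ t
    s⊑t u u-large (j , refl) = j , kept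
      where
      kept : swapped j ≡ root s j
      kept with j ≟ i
      ... | yes refl = contradiction u-large i-small
      ... | no _     = refl

  unsaturated : RootSystem G k
  unsaturated = record { root = f ; injective = f-inj ; dense = f-dense }
  saturated : ∃ λ s → unsaturated ⊑ s × ∀ v → Done v s
  saturated = perform _⊑_ (λ _ _ → id) (λ s⊑t t⊑u v large → t⊑u v large ∘ s⊑t v large) n Done (λ v s⊑t d large → s⊑t v large (d large)) step
    unsaturated

theorem1 : (G : Graph) → GirthAtLeast G 9 → (b m : ℕ) → IsBChromaticNumber G b → IsMNumber G m → m ∸ 1 ≤ b
theorem1 G girth≥9 b zero    _             _        = z≤n
theorem1 G girth≥9 b (suc k) (_ , largest) m-number with s , large-root ← rootSystem G m-number =
  [ (λ h → ≤-trans (n≤1+n k) (largest _ h)) , largest _ ]′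
    (LargeGirth.Roots.hasBColoring G girth≥9 (RootSystem.root s) (RootSystem.injective s) (RootSystem.dense s) large-root)
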